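{- For any fixed $k\in\mathbb{N}$, the pair $(\mathbb{CW}_k,\sqsubseteq_{\mathbb{CW}})$ is a well quasi ordering.
   Context: $Q$ is a fixed finite set of states, with a variable $v_q$ ranging over $\mathbb{N}$ for each $q\in Q$. For $n\in\mathbb N$, $\overline{n}=\{1,\dots,n\}$. For a word $w=w_1\cdots w_n$, $w_{[i]}=w_i$ and $w_{[i,j]}=w_i\cdots w_j$ (empty if $j<i$). A counter is a conjunction $cr=[\bigwedge_{q\in Q}(v_q\sim_q k_q)]$ with each $\sim_q\in\{=,\geq\}$ and $k_q\in\mathbb{N}$; $cr(q)$ denotes the predicate $(v_q\sim_q k_q)$. $\mathbb{C}$ is the set of counters. For $w\in Q^*$, $cr[w]$ means that $cr$ holds when each $v_q$ is the number of occurrences of $q$ in $w$. $cr\sqsubseteq_{\mathbb{C}}cr'$ means that $cr'$ implies $cr$. The precision $\kappa(cr)$ maps $q$ to $0$ if $cr(q)=(v_q\geq k)$ and to $k+1$ if $cr(q)=(v_q=k)$. $\mathbb{C}_k=\{cr\mid\kappa(cr)(q)\le k\text{ for each }q\in Q\}$. A counted word is a finite word $\varphi=(l_1,q_1,r_1)\cdots(l_n,q_n,r_n)$ over $\mathbb{C}\times Q\times\mathbb{C}$; its base is $\underline{\varphi}=q_1\cdots q_n$. It is well formed if $l_i[\underline{\varphi}_{[1,i-1]}]$ and $r_i[\underline{\varphi}_{[i+1,n]}]$ hold for each $1\le i\le n$ (the empty word $\epsilon$ is well formed). $\mathbb{CW}$ is the set of well formed counted words, and $\mathbb{CW}_k$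 is the set of those $\varphi\in\mathbb{CW}$ all of whose counters are in $\mathbb{C}_k$. Entailment: for $\varphi=(l_1,q_1,r_1)\cdots(l_n,q_n,r_n)$ and $\varphi'=(l'_1,q'_1,r'_1)\cdots(l'_m,q'_m,r'_m)$, $\varphi\sqsubseteq_{\mathbb{CW}}\varphi'$ holds iff there is a strictly increasing injection $h:\overline{n}\to\overline{m}$ such that for each $1\le i\le n$: $q_i=q'_{h(i)}$, $l_i\sqsubseteq_{\mathbb{C}}l'_{h(i)}$ and $r_i\sqsubseteq_{\mathbb{C}}r'_{h(i)}$. A pair $(\Sigma,\preceq)$, $\preceq$ a reflexive transitive relation, is a well quasi ordering if there is no infinite sequence $\sigma_1,\sigma_2,\dots$ in $\Sigma$ with $\sigma_i\not\preceq\sigma_j$ for all $i<j$. -}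

module Defs where

open import Data.Fin.Base as Fin using (Fin; toℕ)
open import Data.Fin.Properties using (inj⇒≟)
open import Data.List.Base using (List; length; map; lookup; filter; take; drop)
open import Data.Nat.Base using (ℕ; suc; _≤_; _≥_; _<_)
open import Data.Product.Base using (Σ; ∃; _×_; _,_; proj₁; proj₂)
open import Function.Base using (_on_)
open import Function.Bundles using (_↔_)
open import Function.Definitions using (Injective)
open import Function.Properties.Inverse using (↔⇒↣)
open import Level using (_⊔_)
open import Relation.Binary.Core using (Rel)
open import Relation.Binary.Definitions using (DecidableEquality; Monotonic₁)
open import Relation.Binary.PropositionalEquality.Core using (_≡_)
open import Relation.Binary.Structures using (IsPreorder)
open import Relation.Nullary.Negation.Core using (¬_)

record IsWQO {a ℓ} {A : Set a} (_≼_ : Rel A ℓ) : Set (a ⊔ ℓ) where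
  field
    isPreorder    : IsPreorder _≡_ _≼_
    noBadSequence : ¬ (∃ λ (σ : ℕ → A) → ∀ i j → i < j → ¬ (σ i ≼ σ j))

module CountedWords {n : ℕ} (Q : Set) (Q↔Fin : Q ↔ Fin n) where

  _≟_ : DecidableEquality Q
  _≟_ = inj⇒≟ (↔⇒↣ Q↔Fin)

  occurrences : Q → List Q → ℕ
  occurrences q w = length (filter (q ≟_) w)

  -- `eq k` at q stands for v_q = k, and `geq k` for v_q ≥ k.
  data Constraint : Set where
    eq geq : ℕ → Constraint

  Satisfies : ℕ → Constraint → Set
  Satisfies v (eq k)  = v ≡ k
  Satisfies v (geq k) = v ≥ k

  Counter : Set
  Counter = Q → Constraint

  Holds : Counter → (Q → ℕ) → Set
  Holds cr v = ∀ q → Satisfies (v q) (cr q)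

  _[_] : Counter → List Q → Set
  cr [ w ] = Holds cr (λ q → occurrences q w)

  -- The larger counter is the logically stronger one.
  _⊑ᶜ_ : Rel Counter _
  cr ⊑ᶜ cr′ = ∀ v → Holds cr′ v → Holds cr v

  κ : Counter → Q → ℕ
  κ cr q with cr q
  ... | geq _ = 0
  ... | eq k  = suc k

  _∈ℂ_ : Counter → ℕ → Set
  cr ∈ℂ k = ∀ q → κ cr q ≤ k

  Letter : Set
  Letter = Counter × Q × Counter

  left right : Letter → Counter
  left  (l , _ , _) = l
  right (_ , _ , r) = r

  state : Letter → Q
  state (_ , q , _) = q

  CountedWord : Set
  CountedWord = List Letter

  base : CountedWord → List Q
  base = map state

  -- Positions count from 0, so the letters strictly before position i are
  -- `take i` and those strictly after it are `drop (suc i)`.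
  WellFormed : CountedWord → Set
  WellFormed φ = ∀ (i : Fin (length φ)) →
    left  (lookup φ i) [ take (toℕ i) (base φ) ] ×
    right (lookup φ i) [ drop (suc (toℕ i)) (base φ) ]

  CW : Set
  CW = Σ CountedWord WellFormed

  CW[_] : ℕ → Set
  CW[ k ] = Σ CW λ (φ , _) → ∀ (i : Fin (length φ)) →
    left (lookup φ i) ∈ℂ k × right (lookup φ i) ∈ℂ k

  _⊑ᴸ_ : Rel Letter _
  (l , q , r) ⊑ᴸ (l′ , q′ , r′) = q ≡ q′ × l ⊑ᶜ l′ × r ⊑ᶜ r′

  _⊑_ : Rel CountedWord _
  φ ⊑ φ′ = ∃ λ (h : Fin (length φ) → Fin (length φ′)) →
    Injective _≡_ _≡_ h ×
    Monotonic₁ Fin._<_ Fin._<_ h ×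
    (∀ i → lookup φ i ⊑ᴸ lookup φ′ (h i))

  _⊑ᶜʷ_ : Rel CW _
  _⊑ᶜʷ_ = _⊑_ on proj₁

  EntailmentOn : ∀ k → Rel CW[ k ] _
  EntailmentOn k = _⊑ᶜʷ_ on proj₁

{-# OPTIONS --safe #-}
-- A relation R is well quasi ordered as soon as each of its residuals
-- { y | ¬ R x y } is; read inductively (`WQO`), this excludes infinite bad
-- sequences and is inherited along order-reflecting maps.  For Higman's lemma,
-- cut a word that does not embed a ∷ w at its first letter above a: the letters
-- before the cut lie in the residual of a, and the word after it lies in the
-- residual of w.  A counter of precision at most k takes at each state a value
-- in the well quasi order Fin k ⊎ ℕ (exact values below k, lower bounds), so
-- letters are well quasi ordered by Dickson's lemma and words by Higman's.
module Submission where

open import Defs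
open import Data.Nat.Base using (ℕ)
open import Data.Fin.Base using (Fin)
open import Function.Bundles using (_↔_)

open import Data.Fin.Base as Fin using (zero; suc; punchOut; fromℕ<)
import Data.Fin.Properties as Fin
open import Data.List.Base using (List; []; _∷_; _++_; map; lookup; length; tabulate)
open import Data.List.Relation.Binary.Sublist.Heterogeneous
  using (Sublist; []; _∷_; _∷ʳ_; minimum)
open import Data.List.Relation.Binary.Sublist.Heterogeneous.Properties
  using (map⁺; ++⁺; ++ˡ; sublist?)
import Data.Nat.Base as ℕ
import Data.Nat.Properties as ℕ
open import Data.Product.Base using (Σ; ∃; _×_; _,_; proj₁; proj₂)
open import Data.Product.Relation.Binary.Pointwise.NonDependent
  using (×-decidable) renaming (Pointwise to _×ᴿ_)
open import Data.Sum.Base using (_⊎_; inj₁; inj₂)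
open import Data.Sum.Relation.Binary.Pointwise
  using (inj₁; inj₂; ⊎-decidable) renaming (Pointwise to _⊎ᴿ_)
open import Function.Base using (_on_; _∘_; id)
open import Function.Bundles using (Injection; Inverse)
open import Function.Properties.Inverse using (↔⇒↣)
open import Level using (0ℓ)
open import Relation.Binary.Core using (Rel)
open import Relation.Binary.Definitions using (Decidable; Monotonic₁; tri<; tri≈; tri>)
open import Relation.Binary.PropositionalEquality
  using (_≡_; refl; sym; trans; subst; isEquivalence)
open import Relation.Nullary using (¬_; yes; no; contradiction)

-- Inductive well quasi orders.

private variable
  A B : Set
  R S : Rel A 0ℓ

Residual : Rel A 0ℓ → A → Set
Residual R x = Σ _ λ y → ¬ R x y

data WQO {A : Set} (R : Rel A 0ℓ) : Set where
  sup : (∀ x → WQO {Residual R x} (R on proj₁)) → WQO R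

-- The tail of a bad sequence lies in the residual of its first term and is again bad, so the
-- recursion descends into `f (σ 0)`.
WQO⇒noBadSequence : WQO R → ¬ (∃ λ (σ : ℕ → A) → ∀ i j → i ℕ.< j → ¬ R (σ i) (σ j))
WQO⇒noBadSequence (sup f) (σ , bad) = WQO⇒noBadSequence (f (σ 0))
  ( (λ i → σ (ℕ.suc i) , bad 0 (ℕ.suc i) ℕ.z<s)
  , λ i j i<j → bad (ℕ.suc i) (ℕ.suc j) (ℕ.s<s i<j))

-- Since `f` reflects the order, it restricts to a map from the residual of `x` to that of `f x`.
comap : (f : A → B) → (∀ {x y} → S (f x) (f y) → R x y) → WQO S → WQO R
comap f reflects (sup g) = sup λ x →
  comap (λ (y , x⋠y) → f y , x⋠y ∘ reflects) reflects (g (f x))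

empty : ¬ A → WQO {A} R
empty ¬a = sup λ x → contradiction x ¬a

full : (∀ x y → R x y) → WQO R
full total = sup λ x → empty λ (y , x⋠y) → x⋠y (total x y)

-- Sums, products, finite sets and numbers.

infixr 3 _⊎-wqo_

-- Elements of different summands are never related, so a residual shrinks one summand and keeps the
-- other whole; each call descends in exactly one derivation.
_⊎-wqo_ : WQO R → WQO S → WQO (R ⊎ᴿ S)
_⊎-wqo_ {R = R} {S = S} wR@(sup f) wS@(sup g) = sup λ where
    (inj₁ x) → comap (cutˡ x) (reflectsˡ x) (f x ⊎-wqo wS)
    (inj₂ y) → comap (cutʳ y) (reflectsʳ y) (wR ⊎-wqo g y)
  where
  cutˡ : ∀ x → Residual (R ⊎ᴿ S) (inj₁ x) → Residual R x ⊎ _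
  cutˡ x (inj₁ x′ , x⋠) = inj₁ (x′ , x⋠ ∘ inj₁)
  cutˡ x (inj₂ y′ , _)  = inj₂ y′

  cutʳ : ∀ y → Residual (R ⊎ᴿ S) (inj₂ y) → _ ⊎ Residual S y
  cutʳ y (inj₁ x′ , _)  = inj₁ x′
  cutʳ y (inj₂ y′ , y⋠) = inj₂ (y′ , y⋠ ∘ inj₂)

  reflectsˡ : ∀ x {u v} → ((R on proj₁) ⊎ᴿ S) (cutˡ x u) (cutˡ x v) →
              (R ⊎ᴿ S) (proj₁ u) (proj₁ v)
  reflectsˡ x {inj₁ _ , _} {inj₁ _ , _} (inj₁ r) = inj₁ r
  reflectsˡ x {inj₂ _ , _} {inj₂ _ , _} (inj₂ s) = inj₂ s

  reflectsʳ : ∀ y {u v} → (R ⊎ᴿ (S on proj₁)) (cutʳ y u) (cutʳ y v) →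
              (R ⊎ᴿ S) (proj₁ u) (proj₁ v)
  reflectsʳ y {inj₁ _ , _} {inj₁ _ , _} (inj₁ r) = inj₁ r
  reflectsʳ y {inj₂ _ , _} {inj₂ _ , _} (inj₂ s) = inj₂ s

-- A pair not above (x , y) has its first component not above x or its second
-- one not above y; decidability of R tells which.
×-wqo : Decidable R → WQO R → WQO S → WQO (R ×ᴿ S)
×-wqo {R = R} {S = S} R? wR@(sup f) wS@(sup g) = sup λ (x , y) →
    comap (cut x y) (λ {u} {v} → reflects x y {u} {v})
      (×-wqo (λ u v → R? (proj₁ u) (proj₁ v)) (f x) wS ⊎-wqo ×-wqo R? wR (g y))
  where
  cut : ∀ x y → Residual (R ×ᴿ S) (x , y) → (Residual R x × _) ⊎ (_ × Residual S y)
  cut x y ((x′ , y′) , ⋠) with R? x x′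
  ... | yes x≼x′ = inj₂ (x′ , y′ , λ y≼y′ → ⋠ (x≼x′ , y≼y′))
  ... | no  x⋠x′ = inj₁ ((x′ , x⋠x′) , y′)

  reflects : ∀ x y {u v} →
    (((R on proj₁) ×ᴿ S) ⊎ᴿ (R ×ᴿ (S on proj₁))) (cut x y u) (cut x y v) →
    (R ×ᴿ S) (proj₁ u) (proj₁ v)
  reflects x y {(u₁ , _) , _} {(v₁ , _) , _} p with R? x u₁ | R? x v₁ | p
  ... | yes _ | yes _ | inj₂ q = q
  ... | no  _ | no  _ | inj₁ q = q

-- The residual of a point of `Fin (suc n)` is the `n` other points, which `punchOut` renumbers
-- injectively.
≡-wqo : ∀ n → WQO {Fin n} _≡_
≡-wqo ℕ.zero    = empty λ ()
≡-wqo (ℕ.suc n) = sup λ i →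
  comap (λ (_ , i≢j) → punchOut i≢j)
        (λ {(_ , i≢j)} {(_ , i≢k)} → Fin.punchOut-injective i≢j i≢k)
        (≡-wqo n)

-- Each residual is an initial segment, hence finite, and there equality already suffices.
≤-wqo : WQO ℕ._≤_
≤-wqo = sup λ n →
  comap (λ (_ , n≰m) → fromℕ< (ℕ.≰⇒> n≰m))
        (λ eq → ℕ.≤-reflexive (Fin.fromℕ<-injective _ _ _ _ eq))
        (≡-wqo n)

Pointwise : ∀ {n} → Rel A 0ℓ → Rel (Fin n → A) 0ℓ
Pointwise R f g = ∀ i → R (f i) (g i)

dickson : Decidable R → WQO R → ∀ n → WQO (Pointwise {n = n} R)
dickson R? w ℕ.zero    = full λ _ _ ()
dickson R? w (ℕ.suc n) =
  comap (λ f → f zero , f ∘ suc)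
        (λ (p , q) → λ { zero → p ; (suc i) → q i })
        (×-wqo R? w (dickson R? w n))

-- Higman's lemma.

data FirstAbove (R : Rel A 0ℓ) (a : A) : List A → Set where
  none : (u : List (Residual R a)) → FirstAbove R a (map proj₁ u)
  at   : (u : List (Residual R a)) (x : A) → R a x → (t : List A) →
         FirstAbove R a (map proj₁ u ++ x ∷ t)

firstAbove : Decidable R → ∀ a v → FirstAbove R a v
firstAbove R? a []      = none []
firstAbove R? a (x ∷ v) with R? a x | firstAbove R? a v
... | yes a≼x | _            = at [] x a≼x v
... | no  a⋠x | none u       = none ((x , a⋠x) ∷ u)
... | no  a⋠x | at u y a≼y t = at ((x , a⋠x) ∷ u) y a≼y t

-- Nested induction: `f a` handles words over the residual of `a`, recursion on `w` handles what
-- follows the cut. The cutting letter lies outside that residual, so `wR` compares it.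
higman : Decidable R → WQO R → WQO (Sublist R)
higman {A} {R} R? wR@(sup f) = sup residual
  where
  residual : ∀ w → WQO {Residual (Sublist R) w} (Sublist R on proj₁)
  residual []      = empty λ (v , []⋠v) → []⋠v (minimum v)
  residual (a ∷ w) =
    comap (λ (v , ⋠v) → cut (firstAbove R? a v) ⋠v)
          (λ {(v , _)} {(v′ , _)} → reflects (firstAbove R? a v) (firstAbove R? a v′))
          (higmanₐ ⊎-wqo
           ×-wqo (sublist? R?ₐ) higmanₐ (×-wqo R? wR (residual w)))
    where
    R?ₐ : Decidable {A = Residual R a} (R on proj₁)
    R?ₐ x y = R? (proj₁ x) (proj₁ y)

    higmanₐ : WQO {List (Residual R a)} (Sublist (R on proj₁))
    higmanₐ = higman R?ₐ (f a)

    cut : ∀ {v} → FirstAbove R a v → ¬ Sublist R (a ∷ w) v →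
          List (Residual R a) ⊎ (List (Residual R a) × A × Residual (Sublist R) w)
    cut (none u)       _  = inj₁ u
    -- An embedding of `w` into `t` would extend to `a ∷ w` by skipping `u` and sending `a` to `x`.
    cut (at u x a≼x t) ⋠v = inj₂ (u , x , t , λ w≼t → ⋠v (++ˡ (map proj₁ u) (a≼x ∷ w≼t)))

    reflects : ∀ {v v′} (c : FirstAbove R a v) (c′ : FirstAbove R a v′) {⋠v ⋠v′} →
      (Sublist (R on proj₁) ⊎ᴿ (Sublist (R on proj₁) ×ᴿ (R ×ᴿ (Sublist R on proj₁))))
        (cut c ⋠v) (cut c′ ⋠v′) →
      Sublist R v v′
    -- Matching on the views replaces `v` and `v′` by their decompositions; views of different shape
    -- land in different summands.
    reflects (none _)     (none _)     (inj₁ u≼u′)                = map⁺ proj₁ proj₁ u≼u′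
    reflects (at _ _ _ _) (at _ _ _ _) (inj₂ (u≼u′ , x≼x′ , t≼t′)) =
      ++⁺ (map⁺ proj₁ proj₁ u≼u′) (x≼x′ ∷ t≼t′)

-- Position maps from sublist embeddings.

tabulate-Sublist⁻ : ∀ {m n} (f : Fin m → A) (g : Fin n → A) →
  Sublist R (tabulate f) (tabulate g) →
  ∃ λ (h : Fin m → Fin n) → Monotonic₁ Fin._<_ Fin._<_ h × (∀ i → R (f i) (g (h i)))
tabulate-Sublist⁻ {m = ℕ.zero} f g _ = (λ ()) , (λ { {()} }) , λ ()
-- A skipped letter shifts every image by one; matched heads, in the next clause, send `zero` to
-- `zero`.
tabulate-Sublist⁻ {m = ℕ.suc _} {ℕ.suc _} f g (_ ∷ʳ s) =
  let h , mono , rel = tabulate-Sublist⁻ f (g ∘ suc) s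
  in suc ∘ h , ℕ.s<s ∘ mono , rel
tabulate-Sublist⁻ {R = R} {m = ℕ.suc m} {ℕ.suc n} f g (r ∷ s) =
  let h , mono , rel = tabulate-Sublist⁻ (f ∘ suc) (g ∘ suc) s
  in lift h , lift-mono mono , λ { zero → r ; (suc i) → rel i }
  where
  lift : (Fin m → Fin n) → Fin (ℕ.suc m) → Fin (ℕ.suc n)
  lift = Fin.lift 1

  lift-mono : ∀ {h} → Monotonic₁ Fin._<_ Fin._<_ h → Monotonic₁ Fin._<_ Fin._<_ (lift h)
  lift-mono mono {zero}  {suc _} _           = ℕ.z<s
  lift-mono mono {suc _} {suc _} (ℕ.s<s i<j) = ℕ.s<s (mono i<j)

mono-<⇒injective : ∀ {m n} {h : Fin m → Fin n} → Monotonic₁ Fin._<_ Fin._<_ h →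
                   ∀ {i j} → h i ≡ h j → i ≡ j
mono-<⇒injective mono {i} {j} eq with Fin.<-cmp i j
... | tri< i<j _ _ = contradiction (mono i<j) (Fin.<-irrefl eq)
... | tri≈ _ i≡j _ = i≡j
... | tri> _ _ j<i = contradiction (mono j<i) (Fin.<-irrefl (sym eq))

-- Coding counted words of bounded precision.

module _ {n : ℕ} (Q : Set) (Q↔Fin : Q ↔ Fin n) where
  open CountedWords Q Q↔Fin
  open Inverse Q↔Fin using (to; from; strictlyInverseʳ)

  ⊑-refl : ∀ φ → φ ⊑ φ
  ⊑-refl φ = id , id , id , λ _ → refl , (λ _ → id) , (λ _ → id)

  ⊑-trans : ∀ φ ψ χ → φ ⊑ ψ → ψ ⊑ χ → φ ⊑ χ
  ⊑-trans φ ψ χ (g , g-inj , g-mono , φ≼ψ) (h , h-inj , h-mono , ψ≼χ) =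
    h ∘ g , g-inj ∘ h-inj , h-mono ∘ g-mono , λ i →
      let q≡ , l≼ , r≼ = φ≼ψ i ; q≡′ , l≼′ , r≼′ = ψ≼χ (g i)
      in trans q≡ q≡′ , (λ v → l≼ v ∘ l≼′ v) , (λ v → r≼ v ∘ r≼′ v)

  module _ (k : ℕ) where

    _≼ᵛ_ : Rel (Fin k ⊎ ℕ) 0ℓ
    _≼ᵛ_ = _≡_ ⊎ᴿ ℕ._≤_

    _≼ᵛ?_ : Decidable _≼ᵛ_
    _≼ᵛ?_ = ⊎-decidable Fin._≟_ ℕ._≤?_

    value : ∀ cr → cr ∈ℂ k → Q → Fin k ⊎ ℕ
    value cr b q with cr q | b q
    -- Here `κ cr q` has computed to the successor of the exact value, so `b q` is a strict bound.
    ... | eq  _ | c<k = inj₁ (fromℕ< c<k)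
    ... | geq c | _   = inj₂ c

    -- Related exact values coincide, and related lower bounds grow. An exact value is never related
    -- to a lower bound, even if it implies one: the code order only has to reflect implication.
    value-reflects : ∀ cr cr′ (b : cr ∈ℂ k) (b′ : cr′ ∈ℂ k) q → value cr b q ≼ᵛ value cr′ b′ q →
                     ∀ v → Satisfies v (cr′ q) → Satisfies v (cr q)
    value-reflects cr cr′ b b′ q p v sat with cr q | b q | cr′ q | b′ q | p
    ... | eq _  | _ | eq _  | _ | inj₁ c≡c′
      rewrite Fin.fromℕ<-injective _ _ _ _ c≡c′ = sat
    ... | geq _ | _ | geq _ | _ | inj₂ c≤c′ = ℕ.≤-trans c≤c′ sat

    -- Implication between counters quantifies over all valuations; codes have a visibly decidable
    -- order, as `×-wqo` and `higman` demand, and `Fin n` suits the recursion of `dickson`.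
    CounterCode LetterCode : Set
    CounterCode = Fin n → Fin k ⊎ ℕ
    LetterCode  = CounterCode × Fin n × CounterCode

    counterCode : ∀ cr → cr ∈ℂ k → CounterCode
    counterCode cr b = value cr b ∘ from

    counterCode-reflects : ∀ cr cr′ (b : cr ∈ℂ k) (b′ : cr′ ∈ℂ k) →
      Pointwise _≼ᵛ_ (counterCode cr b) (counterCode cr′ b′) → cr ⊑ᶜ cr′
    counterCode-reflects cr cr′ b b′ p v holds q =
      value-reflects cr cr′ b b′ q
        -- The hypothesis at `to q` concerns the state `from (to q)`, which is `q`.
        (subst (λ q → value cr b q ≼ᵛ value cr′ b′ q) (strictlyInverseʳ q) (p (to q)))
        (v q) (holds q)

    _≼ᶜ_ : Rel CounterCode 0ℓ
    _≼ᶜ_ = Pointwise _≼ᵛ_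

    _≼ᶜ?_ : Decidable _≼ᶜ_
    f ≼ᶜ? g = Fin.all? λ i → f i ≼ᵛ? g i

    _≼ᴸ_ : Rel LetterCode 0ℓ
    _≼ᴸ_ = _≼ᶜ_ ×ᴿ (_≡_ ×ᴿ _≼ᶜ_)

    _≼ᴸ?_ : Decidable _≼ᴸ_
    _≼ᴸ?_ = ×-decidable _≼ᶜ?_ (×-decidable Fin._≟_ _≼ᶜ?_)

    ≼ᶜ-wqo : WQO _≼ᶜ_
    ≼ᶜ-wqo = dickson _≼ᵛ?_ (≡-wqo k ⊎-wqo ≤-wqo) n

    ≼ᴸ-wqo : WQO _≼ᴸ_
    ≼ᴸ-wqo = ×-wqo _≼ᶜ?_ ≼ᶜ-wqo (×-wqo Fin._≟_ (≡-wqo n) ≼ᶜ-wqo)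

    letterCode : (a : Letter) → left a ∈ℂ k × right a ∈ℂ k → LetterCode
    letterCode (l , q , r) (bl , br) = counterCode l bl , to q , counterCode r br

    letterCode-reflects : ∀ a a′ b b′ → letterCode a b ≼ᴸ letterCode a′ b′ → a ⊑ᴸ a′
    letterCode-reflects (l , q , r) (l′ , q′ , r′) (bl , br) (bl′ , br′) (l≼ , q≡ , r≼) =
      Injection.injective (↔⇒↣ Q↔Fin) q≡ ,
      counterCode-reflects l l′ bl bl′ l≼ ,
      counterCode-reflects r r′ br br′ r≼

    -- Precision bounds are given by position, so the coding is too; `tabulate` later yields the
    -- list for `higman`.
    letterCodes : (((φ , _) , _) : CW[ k ]) → Fin (length φ) → LetterCode
    letterCodes ((φ , _) , b) i = letterCode (lookup φ i) (b i)

    letterCodes-reflects : ∀ φ ψ →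
      Sublist _≼ᴸ_ (tabulate (letterCodes φ)) (tabulate (letterCodes ψ)) → EntailmentOn k φ ψ
    letterCodes-reflects φ@((u , _) , b) ψ@((v , _) , c) s =
      let h , mono , rel = tabulate-Sublist⁻ (letterCodes φ) (letterCodes ψ) s
      in h , mono-<⇒injective mono , mono , λ i →
         letterCode-reflects (lookup u i) (lookup v (h i)) (b i) (c (h i)) (rel i)

    entailment-wqo : WQO (EntailmentOn k)
    entailment-wqo = comap (tabulate ∘ letterCodes) (λ {φ} {ψ} → letterCodes-reflects φ ψ)
                           (higman _≼ᴸ?_ ≼ᴸ-wqo)

theorem2 : ∀ {n : ℕ} (Q : Set) (Q↔Fin : Q ↔ Fin n) (k : ℕ) →
    IsWQO (CountedWords.EntailmentOn Q Q↔Fin k)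
theorem2 Q Q↔Fin k = record
  { isPreorder = record
    { isEquivalence = isEquivalence
    ; reflexive     = λ { {(φ , _) , _} refl → ⊑-refl Q Q↔Fin φ }
    ; trans         = λ { {(φ , _) , _} {(ψ , _) , _} {(χ , _) , _} → ⊑-trans Q Q↔Fin φ ψ χ }
    }
  ; noBadSequence = WQO⇒noBadSequence (entailment-wqo Q Q↔Fin k)
  }
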